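{- Let $H$ be a finite simple graph whose edges are colored red and blue. Let $P$ be a maximum packing in $\mathcal F(H)$ and let $Q$ be a maximum packing in $\mathcal F_P$. Put $p=|P|$ and $q=|Q|$, and let $u$ be the number of members of $P$ whose red edge is private in $\mathcal F(H)$. Then $$\tau(\mathcal F(H))\le\tfrac83\,p-\tfrac23\,u$$ and $$\tau(\mathcal F(H))\le\tfrac94\,p+\tfrac32\,q-\tfrac14\,u.$$
   Context: Graphs are finite and simple, and a triangle is identified with its set of three edges. For a family of triangles, a packing is a set of pairwise edge-disjoint members of the family; a maximum packing is one of largest size. A transversal of a family of triangles is a set of edges containing at least one edge of every member, and $\tau$ of a family denotes the minimum size of a transversal of it. For a graph $H$ whose edges are each colored red or blue, $\mathcal F(H)$ denotes the family of all triangles of $H$ with exactly one red edge (and hence two blue edges). For a packing $P$ in $\mathcal F(H)$, $B(P)$ denotes the set of blue edges of the members of $P$. $H-X$ denotes $H$ with the edge set $X$ deleted (keeping the coloring of the remaining edges), and $\mathcal F_P=\mathcal F(H-B(P))$. An edge is private in a family of triangles if exactly one member of the family contains it. -}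

module Defs where

open import Data.Nat using (ℕ; zero; suc; _≤_; z≤n; s≤s)
import Data.Nat.Properties as ℕ
open import Data.Integer using (+_)
open import Data.Rational using (ℚ; _/_)
open import Data.Fin using (Fin; _<_)
import Data.Fin.Properties as Fin
open import Data.Bool using (if_then_else_)
open import Data.Maybe using (Maybe; just; nothing; Is-just)
import Data.Maybe.Properties as Maybe
import Data.Maybe.Relation.Unary.Any as MAny
open import Data.List using (List; []; _∷_; length; filter; concatMap; allFin; deduplicate)
open import Data.List.Membership.Propositional using (_∈_; lose)
open import Data.List.Membership.Propositional.Properties using (∈-concatMap⁺; ∈-allFin; ∈-deduplicate⁺)
import Data.List.Membership.DecPropositional as DecMembership
open import Data.List.Relation.Unary.All using (All; all?)
open import Data.List.Relation.Unary.Any using (Any; any?; here; there)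
open import Data.List.Relation.Unary.AllPairs using (AllPairs; allPairs?)
open import Data.List.Relation.Unary.Unique.Propositional using (Unique)
import Data.List.Relation.Unary.Unique.DecPropositional.Properties as UniqueDec
open import Data.List.Relation.Binary.Disjoint.Propositional using (Disjoint)
open import Data.Product using (∃; ∃-syntax; ∃!; _×_; _,_; proj₁; proj₂)
open import Data.Unit using (tt)
open import Function using (_∘_)
open import Level using (0ℓ)
open import Relation.Binary.Definitions using (DecidableEquality)
open import Relation.Binary.PropositionalEquality using (_≡_; refl; sym; subst)
open import Relation.Nullary using (Dec; yes; no; does; ¬?; contradiction)
open import Relation.Nullary.Decidable using (_×-dec_; _→-dec_; map′; recompute)
open import Relation.Unary using (Pred; Decidable)

-- An unordered pair of distinct vertices, written in increasing order.  The
-- bound is irrelevant, so edges with the same endpoints are equal.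
record Edge (n : ℕ) : Set where
  constructor edge
  field
    lo hi   : Fin n
    .lo<hi : lo < hi

-- Vertices in increasing order, so that each set of three edges forming a
-- triangle is represented exactly once.
record Triangle (n : ℕ) : Set where
  constructor triangle
  field
    a b c : Fin n
    .a<b : a < b
    .b<c : b < c

edges : ∀ {n} → Triangle n → List (Edge n)
edges (triangle a b c a<b b<c) =
  edge a b a<b ∷ edge a c (Fin.<-trans a<b b<c) ∷ edge b c b<c ∷ []

infix 4 _≟ₑ_ _≟ₜ_

_≟ₑ_ : ∀ {n} → DecidableEquality (Edge n)
edge i j _ ≟ₑ edge k l _ = map′ (λ { (refl , refl) → refl }) (λ { refl → refl , refl })
  (i Fin.≟ k ×-dec j Fin.≟ l)

_≟ₜ_ : ∀ {n} → DecidableEquality (Triangle n)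
triangle a b c _ _ ≟ₜ triangle d e f _ _ =
  map′ (λ { (refl , refl , refl) → refl }) (λ { refl → refl , refl , refl })
    (a Fin.≟ d ×-dec b Fin.≟ e ×-dec c Fin.≟ f)

module _ {n : ℕ} where
  open DecMembership (_≟ₑ_ {n}) public using () renaming (_∈?_ to _∈ₑ?_)

data Colour : Set where
  red blue : Colour

_≟ᶜ_ : DecidableEquality Colour
red  ≟ᶜ red  = yes refl
red  ≟ᶜ blue = no λ ()
blue ≟ᶜ red  = no λ ()
blue ≟ᶜ blue = yes refl

-- A simple graph on Fin n with coloured edges: the pairs sent to nothing are
-- the non-edges, the pairs sent to just c are the edges of colour c.
ColouredGraph : ℕ → Set
ColouredGraph n = Edge n → Maybe Colour

Family : ℕ → Set₁
Family n = Pred (Triangle n) 0ℓ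

module _ {n : ℕ} where

  IsEdge Red Blue : ColouredGraph n → Pred (Edge n) 0ℓ
  IsEdge H e = Is-just (H e)
  Red    H e = H e ≡ just red
  Blue   H e = H e ≡ just blue

  IsEdge? : ∀ H → Decidable (IsEdge H)
  IsEdge? H e = MAny.dec (λ _ → yes tt) (H e)

  Red? : ∀ H → Decidable (Red H)
  Red? H e = Maybe.≡-dec _≟ᶜ_ (H e) (just red)

  Blue? : ∀ H → Decidable (Blue H)
  Blue? H e = Maybe.≡-dec _≟ᶜ_ (H e) (just blue)

  -- Deletion of an edge set.  Only membership in the list matters.
  infixl 6 _∖_
  _∖_ : ColouredGraph n → List (Edge n) → ColouredGraph n
  (H ∖ X) e = if does (e ∈ₑ? X) then nothing else H e

  𝓕 : ColouredGraph n → Family n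
  𝓕 H T = All (IsEdge H) (edges T) × length (filter (Red? H) (edges T)) ≡ 1

  𝓕? : ∀ H → Decidable (𝓕 H)
  𝓕? H T = all? (IsEdge? H) (edges T) ×-dec (length (filter (Red? H) (edges T)) ℕ.≟ 1)

  -- Members of a packing are automatically distinct, since a triangle is not
  -- edge-disjoint from itself; hence length is cardinality.
  Packing : Family n → List (Triangle n) → Set
  Packing F P = All F P × AllPairs (λ S T → Disjoint (edges S) (edges T)) P

  MaximumPacking : Family n → List (Triangle n) → Set
  MaximumPacking F P = Packing F P × (∀ P′ → Packing F P′ → length P′ ≤ length P)

  B : ColouredGraph n → List (Triangle n) → List (Edge n)
  B H P = filter (Blue? H) (concatMap edges P)

  𝓕[_]after : ColouredGraph n → List (Triangle n) → Family n
  𝓕[ H ]after P = 𝓕 (H ∖ B H P)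

  Private : Family n → Pred (Edge n) 0ℓ
  Private F e = ∃! _≡_ λ T → F T × e ∈ edges T

  -- For members T of 𝓕 H the red edge is unique.
  PrivateRed : ColouredGraph n → Pred (Triangle n) 0ℓ
  PrivateRed H T = Any (λ e → Red H e × Private (𝓕 H) e) (edges T)

  Transversal : Family n → List (Edge n) → Set
  Transversal F X = Unique X × (∀ T → F T → Any (_∈ X) (edges T))

  IsMinTransversalSize : Family n → ℕ → Set
  IsMinTransversalSize F t =
    (∃[ X ] length X ≡ t × Transversal F X) × (∀ X → Transversal F X → t ≤ length X)

  ∃Edge? : ∀ {A : Pred (Edge n) 0ℓ} → Decidable A → Dec (∃ A)
  ∃Edge? {A} A? = map′ (λ { (i , j , p , x) → edge i j p , x })
    (λ { (edge i j p , x) → i , j , recompute (i Fin.<? j) p , x })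
    (Fin.any? λ i → Fin.any? λ j → inner i j)
    where
    inner : ∀ i j → Dec (∃[ p ] A (edge i j p))
    inner i j with i Fin.<? j
    ... | no i≮j = no λ { (p , _) → i≮j p }
    ... | yes p  = map′ (p ,_) proj₂ (A? (edge i j p))

  ∃Triangle? : ∀ {A : Pred (Triangle n) 0ℓ} → Decidable A → Dec (∃ A)
  ∃Triangle? {A} A? = map′ (λ { (a , b , c , p , q , x) → triangle a b c p q , x })
    (λ { (triangle a b c p q , x) →
           a , b , c , recompute (a Fin.<? b) p , recompute (b Fin.<? c) q , x })
    (Fin.any? λ a → Fin.any? λ b → Fin.any? λ c → inner a b c)
    where
    inner : ∀ a b c → Dec (∃[ p ] ∃[ q ] A (triangle a b c p q))
    inner a b c with a Fin.<? b | b Fin.<? c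
    ... | no ≮  | _     = no λ { (p , _) → ≮ p }
    ... | yes _ | no ≮  = no λ { (_ , q , _) → ≮ q }
    ... | yes p | yes q = map′ (λ x → p , q , x) (λ { (_ , _ , x) → x }) (A? (triangle a b c p q))

  ∀Triangle? : ∀ {A : Pred (Triangle n) 0ℓ} → Decidable A → Dec (∀ T → A T)
  ∀Triangle? {A} A? with ∃Triangle? (¬? ∘ A?)
  ... | yes (T , ¬x) = no λ f → ¬x (f T)
  ... | no ∄ = yes all
    where
    all : ∀ T → A T
    all T with A? T
    ... | yes x = x
    ... | no ¬x = contradiction (T , ¬x) ∄

  Private? : ∀ {F : Family n} → Decidable F → Decidable (Private F)
  Private? F? e = map′
    (λ { (T , x , f) → T , x , λ {T′} y → f T′ y })
    (λ { (T , x , f) → T , x , λ T′ y → f {T′} y })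
    (∃Triangle? λ T → member? T ×-dec ∀Triangle? λ T′ → member? T′ →-dec (T ≟ₜ T′))
    where member? = λ T → F? T ×-dec (e ∈ₑ? edges T)

  PrivateRed? : ∀ H → Decidable (PrivateRed H)
  PrivateRed? H T = any? (λ e → Red? H e ×-dec Private? (𝓕? H) e) (edges T)

  Transversal? : ∀ {F : Family n} → Decidable F → Decidable (Transversal F)
  Transversal? F? X = allPairs? (λ d e → ¬? (d ≟ₑ e)) X
    ×-dec ∀Triangle? λ T → F? T →-dec any? (_∈ₑ? X) (edges T)

  edgeBetween : Fin n → Fin n → List (Edge n)
  edgeBetween i j with i Fin.<? j
  ... | yes p = edge i j p ∷ []
  ... | no _  = []

  ∈-edgeBetween : ∀ i j .(p : i < j) → edge i j p ∈ edgeBetween i j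
  ∈-edgeBetween i j p with i Fin.<? j
  ... | yes _   = here refl
  ... | no i≮j = contradiction (recompute (i Fin.<? j) p) i≮j

  allEdges : List (Edge n)
  allEdges =
    deduplicate _≟ₑ_ (concatMap (λ i → concatMap (edgeBetween i) (allFin n)) (allFin n))

  ∈-allEdges : ∀ e → e ∈ allEdges
  ∈-allEdges (edge i j p) = ∈-deduplicate⁺ _≟ₑ_
    (∈-concatMap⁺ _ (lose (∈-allFin i)
      (∈-concatMap⁺ _ (lose (∈-allFin j) (∈-edgeBetween i j p)))))

  allEdges-transversal : ∀ F → Transversal F allEdges
  allEdges-transversal F = UniqueDec.deduplicate-! _≟ₑ_ _ , λ _ _ → here (∈-allEdges _)

  ∃List? : ∀ {A : Pred (List (Edge n)) 0ℓ} → Decidable A → ∀ k → Dec (∃[ X ] length X ≡ k × A X)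
  ∃List? A? zero = map′ (λ x → [] , refl , x) (λ { ([] , _ , x) → x }) (A? [])
  ∃List? A? (suc k) = map′ (λ { (e , X , refl , x) → e ∷ X , refl , x })
    (λ { (e ∷ X , refl , x) → e , X , refl , x })
    (∃Edge? λ e → ∃List? (A? ∘ (e ∷_)) k)

least : ∀ {A : Pred ℕ 0ℓ} → Decidable A → ∀ k → A k → ∃[ m ] A m × (∀ l → A l → m ≤ l)
least A? k x with A? 0
least A? k       x | yes y = 0 , y , λ _ _ → z≤n
least A? zero    x | no ¬y = contradiction x ¬y
least A? (suc k) x | no ¬y with least (A? ∘ suc) k x
... | m , y , min = suc m , y , λ { zero z → contradiction z ¬y ; (suc l) z → s≤s (min l z) }

minTransversalSize : ∀ {n} (F : Family n) → Decidable F → ∃ (IsMinTransversalSize F)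
minTransversalSize F F? with least (∃List? (Transversal? F?)) _ (allEdges , refl , allEdges-transversal F)
... | t , attained , min = t , attained , λ X x → min (length X) (X , refl , x)

τ : ∀ {n} (F : Family n) → Decidable F → ℕ
τ F F? = proj₁ (minTransversalSize F F?)

τ-isMin : ∀ {n} (F : Family n) (F? : Decidable F) → IsMinTransversalSize F (τ F F?)
τ-isMin F F? = proj₂ (minTransversalSize F F?)

fromℕ : ℕ → ℚ
fromℕ k = + k / 1

{-# OPTIONS --safe #-}

-- Write F = 𝓕 H, F′ = 𝓕 (H ∖ B H P), and let u′ count the members of Q whose red edge is private
-- in F′.  Deleting B(P) gives τ(F) ≤ 2p + τ(F′).  A second transversal uses two blue edges of each
-- T ∈ P with private red edge and all three edges of each other T ∈ P, except that a T met by some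
-- N ∈ Q (necessarily in its red edge) contributes only that red edge, together with the edge joining
-- the third vertices of T and N when the red edge of N is private in F′.  A triangle missed by this
-- set would allow T to be exchanged for two triangles, or two members of P for three.  Hence
-- τ(F) + u + 2q ≤ 3p + u′, and for Q = ∅ this says τ(F) + u ≤ 3p; the latter, applied to F′ and Q,
-- reads τ(F′) + u′ ≤ 3q.  The first bound is a combination of these three inequalities, and the
-- second follows from the first two and the first bound for F′ and Q.

module Submission where

open import Defs
open import Data.Nat using (ℕ; zero; suc; z≤n; s≤s)
import Data.Nat as ℕ
import Data.Nat.Properties as ℕ
open import Data.Nat.Solver using (module +-*-Solver)
open import Data.Nat.ListAction using (sum)
open import Data.Integer using (+_)
import Data.Integer as ℤ
import Data.Integer.Properties as ℤ
open import Data.Rational using (_/_; _≤_; _+_; _-_; _*_; toℚᵘ)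
import Data.Rational.Properties as ℚ
import Data.Rational.Unnormalised as ℚᵘ
open import Data.Rational.Unnormalised using (mkℚᵘ)
import Data.Rational.Unnormalised.Properties as ℚᵘ
import Data.Rational.Solver as ℚ
open import Data.Fin using (Fin)
import Data.Fin.Properties as Fin
open import Data.Empty using (⊥; ⊥-elim-irr)
open import Data.Maybe using (just; nothing; Is-just)
open import Data.List using (List; []; _∷_; _++_; length; filter; map; concatMap; deduplicate)
open import Data.List.Properties using (length-filter; length-++; length-++-sucʳ; length-deduplicate; filter-++)
open import Data.List.Membership.Propositional using (_∈_; _∉_; lose; find)
open import Data.List.Membership.Propositional.Properties using (∈-∃++; ∈-++⁺ˡ; ∈-++⁺ʳ; ∈-++⁻; ∈-filter⁺; ∈-filter⁻; ∈-concatMap⁺; ∈-deduplicate⁺)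
import Data.List.Membership.DecPropositional as DecMembership
open import Data.List.Relation.Unary.All as All using (All; []; _∷_)
import Data.List.Relation.Unary.All.Properties as All
open import Data.List.Relation.Unary.Any as Any using (Any; here; there; any?)
open import Data.List.Relation.Unary.AllPairs as AllPairs using (AllPairs; []; _∷_)
import Data.List.Relation.Unary.AllPairs.Properties as AllPairs
open import Data.List.Relation.Unary.Unique.Propositional using (Unique)
import Data.List.Relation.Unary.Unique.DecPropositional.Properties as UniqueDec
open import Data.List.Relation.Binary.Disjoint.Propositional using (Disjoint)
open import Data.List.Relation.Binary.Subset.Propositional using (_⊆_)
open import Data.Product using (∃; _×_; _,_; proj₁; proj₂)
open import Data.Sum using (_⊎_; inj₁; inj₂; [_,_]′)
open import Function using (_∘_; id)
import Relation.Binary.Reasoning.Setoid as SetoidReasoning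
open import Level using (0ℓ)
open import Relation.Binary.Core using (Rel)
open import Relation.Binary.Definitions using (tri<; tri≈; tri>)
open import Relation.Binary.PropositionalEquality using (_≡_; _≢_; refl; sym; trans; cong; cong₂; subst; subst₂)
open import Relation.Nullary using (¬_; Dec; yes; no; ¬?; contradiction)
open import Relation.Nullary.Decidable using (_×-dec_; decidable-stable)
open import Relation.Unary using (Pred; Decidable)

-- Lists and finite sums.

module _ {A : Set} where

  Unique-⊆⇒length≤ : {xs ys : List A} → Unique xs → xs ⊆ ys → length xs ℕ.≤ length ys
  Unique-⊆⇒length≤ [] _ = z≤n
  Unique-⊆⇒length≤ {x ∷ xs} (x∉xs ∷ xs!) xs⊆ with ∈-∃++ (xs⊆ (here refl))
  ... | as , bs , refl = ℕ.≤-trans (s≤s (Unique-⊆⇒length≤ xs! xs⊆as++bs))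
                                   (ℕ.≤-reflexive (sym (length-++-sucʳ as x bs)))
    where
    xs⊆as++bs : xs ⊆ as ++ bs
    xs⊆as++bs y∈xs with ∈-++⁻ as (xs⊆ (there y∈xs))
    ... | inj₁ y∈as         = ∈-++⁺ˡ y∈as
    ... | inj₂ (here refl)  = contradiction refl (All.lookup x∉xs y∈xs)
    ... | inj₂ (there y∈bs) = ∈-++⁺ʳ as y∈bs

  AllPairs-lookup : {R : Rel A 0ℓ} {xs : List A} → AllPairs R xs →
                    ∀ {x y} → x ∈ xs → y ∈ xs → x ≡ y ⊎ R x y ⊎ R y x
  AllPairs-lookup (rs ∷ _)  (here refl) (here refl) = inj₁ refl
  AllPairs-lookup (rs ∷ _)  (here refl) (there y∈)  = inj₂ (inj₁ (All.lookup rs y∈))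
  AllPairs-lookup (rs ∷ _)  (there x∈)  (here refl) = inj₂ (inj₂ (All.lookup rs x∈))
  AllPairs-lookup (_  ∷ ps) (there x∈)  (there y∈)  = AllPairs-lookup ps x∈ y∈

  ∑ : List A → (A → ℕ) → ℕ
  ∑ xs f = sum (map f xs)

  ∑-mono-≤ : ∀ xs {f g : A → ℕ} → (∀ {x} → x ∈ xs → f x ℕ.≤ g x) → ∑ xs f ℕ.≤ ∑ xs g
  ∑-mono-≤ []       f≤g = z≤n
  ∑-mono-≤ (x ∷ xs) f≤g = ℕ.+-mono-≤ (f≤g (here refl)) (∑-mono-≤ xs (f≤g ∘ there))

  ∑-+ : ∀ xs (f g : A → ℕ) → ∑ xs (λ x → f x ℕ.+ g x) ≡ ∑ xs f ℕ.+ ∑ xs g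
  ∑-+ []       f g = refl
  ∑-+ (x ∷ xs) f g rewrite ∑-+ xs f g =
    solve 4 (λ a b c d → (a :+ b) :+ (c :+ d) := (a :+ c) :+ (b :+ d)) refl
      (f x) (g x) (∑ xs f) (∑ xs g)
    where open +-*-Solver

  ∑-const : ∀ xs c → ∑ xs (λ _ → c) ≡ length xs ℕ.* c
  ∑-const []       c = refl
  ∑-const (x ∷ xs) c = cong (c ℕ.+_) (∑-const xs c)

  ∈⇒≤∑ : ∀ {x xs} (f : A → ℕ) → x ∈ xs → f x ℕ.≤ ∑ xs f
  ∈⇒≤∑ f (here refl) = ℕ.m≤m+n _ _
  ∈⇒≤∑ f (there x∈)  = ℕ.≤-trans (∈⇒≤∑ f x∈) (ℕ.m≤n+m _ _)

∑-swap : ∀ {A B : Set} xs ys (f : A → B → ℕ) →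
         ∑ xs (λ x → ∑ ys (f x)) ≡ ∑ ys (λ y → ∑ xs (λ x → f x y))
∑-swap []       ys f = trans (sym (ℕ.*-zeroʳ (length ys))) (sym (∑-const ys 0))
∑-swap (x ∷ xs) ys f =
  trans (cong (∑ ys (f x) ℕ.+_) (∑-swap xs ys f)) (sym (∑-+ ys (f x) _))

⟦_⟧ : {A : Set} → Dec A → ℕ
⟦ yes _ ⟧ = 1
⟦ no _ ⟧  = 0

module _ {A : Set} {P : Pred A 0ℓ} (P? : Decidable P) where

  length-filter-∑ : ∀ xs → length (filter P? xs) ≡ ∑ xs (λ x → ⟦ P? x ⟧)
  length-filter-∑ []       = refl
  length-filter-∑ (x ∷ xs) with P? x
  ... | yes _ = cong suc (length-filter-∑ xs)
  ... | no _  = length-filter-∑ xs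

  -- `P` holds for at most one entry, so at most one term of the sum survives. This evaluates the
  -- part of `demand` that comes from `Q`.
  ∑-indicator : ∀ {xs} (w : A → ℕ) → Unique xs →
    (∀ {x y} → x ∈ xs → y ∈ xs → P x → P y → x ≡ y) →
    let s = ∑ xs (λ x → ⟦ P? x ⟧ ℕ.* w x) in
    All (¬_ ∘ P) xs × s ≡ 0 ⊎ ∃ λ x → x ∈ xs × P x × s ≡ w x
  ∑-indicator w [] _ = inj₁ ([] , refl)
  ∑-indicator {x ∷ xs} w (x∉xs ∷ xs!) P-once
    with P? x | ∑-indicator w xs! (λ y∈ z∈ → P-once (there y∈) (there z∈))
  ... | no ¬px | inj₁ (none , s≡)        = inj₁ (¬px ∷ none , s≡)
  ... | no ¬px | inj₂ (y , y∈ , py , s≡) = inj₂ (y , there y∈ , py , s≡)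
  ... | yes px | inj₁ (_ , s≡)           = inj₂ (x , here refl , px ,
    trans (cong₂ ℕ._+_ (ℕ.+-identityʳ (w x)) s≡) (ℕ.+-identityʳ (w x)))
  ... | yes px | inj₂ (y , y∈ , py , _)  =
    contradiction (P-once (here refl) (there y∈) px py) (All.lookup x∉xs y∈)

  filter-singleton : ∀ xs → length (filter P? xs) ≡ 1 →
    ∃ λ x → x ∈ xs × P x × (∀ {y} → y ∈ xs → P y → y ≡ x)
  filter-singleton xs |f|≡1 with filter P? xs in eq
  filter-singleton xs () | []
  filter-singleton xs () | _ ∷ _ ∷ _
  ... | x ∷ [] with ∈-filter⁻ P? {xs = xs} (subst (x ∈_) (sym eq) (here refl))
  ...   | x∈ , px = x , x∈ , px , λ y∈ py → only (subst (_ ∈_) eq (∈-filter⁺ P? y∈ py))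
    where
    only : ∀ {y} → y ∈ x ∷ [] → y ≡ x
    only (here y≡x) = y≡x

-- Concatenates local covers: `c` is the budget of each `x`, and `f x` the part of it that the cover
-- of `x` must save. Since `G x` survives enlarging the list, it passes from each local cover to
-- their union.
assemble : {A B : Set} {G : A → Pred (List B) 0ℓ} → (∀ {x C D} → C ⊆ D → G x C → G x D) →
  ∀ c (f : A → ℕ) xs → (∀ {x} → x ∈ xs → ∃ λ C → length C ℕ.+ f x ℕ.≤ c × G x C) →
  ∃ λ D → length D ℕ.+ ∑ xs f ℕ.≤ length xs ℕ.* c × (∀ {x} → x ∈ xs → G x D)
assemble mono c f []       cover = [] , z≤n , λ ()
assemble mono c f (x ∷ xs) cover
  with cover (here refl) | assemble mono c f xs (cover ∘ there)
... | C , C≤ , gC | D , D≤ , gD = C ++ D , size ,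
  λ { (here refl) → mono ∈-++⁺ˡ gC ; (there y∈) → mono (∈-++⁺ʳ C) (gD y∈) }
  where
  open +-*-Solver
  size : length (C ++ D) ℕ.+ (f x ℕ.+ ∑ xs f) ℕ.≤ c ℕ.+ length xs ℕ.* c
  size rewrite length-++ C {D} = ℕ.≤-trans (ℕ.≤-reflexive
    (solve 4 (λ p q r s → (p :+ q) :+ (r :+ s) := (p :+ r) :+ (q :+ s)) refl
      (length C) (length D) (f x) (∑ xs f))) (ℕ.+-mono-≤ C≤ D≤)

∑-complement : {A : Set} {P : Pred A 0ℓ} (P? : Decidable P) → ∀ xs →
  ∑ xs (λ x → 2 ℕ.∸ ⟦ P? x ⟧) ℕ.+ length (filter P? xs) ≡ length xs ℕ.* 2
∑-complement P? []       = refl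
∑-complement P? (x ∷ xs) with P? x
... | yes _ = cong suc (trans (ℕ.+-suc _ _) (cong suc (∑-complement P? xs)))
... | no _  = cong (2 ℕ.+_) (∑-complement P? xs)

-- Every `y` is related to at least one `x`, so after the two sums are exchanged `w y` is counted at
-- least once.
∑-double-count : {A B : Set} {R : A → B → Set} {P : Pred A 0ℓ}
  (P? : Decidable P) (R? : ∀ x y → Dec (R x y)) (w : B → ℕ) → ∀ xs ys →
  (∀ {y} → y ∈ ys → ∃ λ x → x ∈ xs × R x y) →
  length (filter P? xs) ℕ.+ ∑ ys w ℕ.≤ ∑ xs (λ x → ⟦ P? x ⟧ ℕ.+ ∑ ys (λ y → ⟦ R? x y ⟧ ℕ.* w y))
∑-double-count P? R? w xs ys related = begin
  length (filter P? xs) ℕ.+ ∑ ys w                             ≡⟨ cong (ℕ._+ ∑ ys w) (length-filter-∑ P? xs) ⟩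
  ∑ xs (λ x → ⟦ P? x ⟧) ℕ.+ ∑ ys w                             ≤⟨ ℕ.+-monoʳ-≤ _ (∑-mono-≤ ys counted) ⟩
  ∑ xs (λ x → ⟦ P? x ⟧) ℕ.+ ∑ ys (λ y → ∑ xs (λ x → c x y))    ≡⟨ cong (∑ xs (λ x → ⟦ P? x ⟧) ℕ.+_) (∑-swap xs ys c) ⟨
  ∑ xs (λ x → ⟦ P? x ⟧) ℕ.+ ∑ xs (λ x → ∑ ys (c x))            ≡⟨ ∑-+ xs (λ x → ⟦ P? x ⟧) (λ x → ∑ ys (c x)) ⟨
  ∑ xs (λ x → ⟦ P? x ⟧ ℕ.+ ∑ ys (c x))                         ∎
  where
  open ℕ.≤-Reasoning
  c = λ x y → ⟦ R? x y ⟧ ℕ.* w y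
  1*w≤ : {C : Set} (c? : Dec C) → C → ∀ k → k ℕ.≤ ⟦ c? ⟧ ℕ.* k
  1*w≤ (yes _) _ k = ℕ.≤-reflexive (sym (ℕ.+-identityʳ k))
  1*w≤ (no ¬r) r k = contradiction r ¬r
  counted : ∀ {y} → y ∈ ys → w y ℕ.≤ ∑ xs (λ x → c x y)
  counted {y} y∈ with related y∈
  ... | x , x∈ , r = ℕ.≤-trans (1*w≤ (R? x y) r (w y)) (∈⇒≤∑ (λ x → c x y) x∈)

-- Edges and triangles described by their vertices.

module _ {n : ℕ} where
  open DecMembership (Fin._≟_ {n}) using () renaming (_∈?_ to _∈ᵥ?_)

  ends : Edge n → List (Fin n)
  ends (edge i j _) = i ∷ j ∷ []

  vertices : Triangle n → List (Fin n)
  vertices (triangle a b c _ _) = a ∷ b ∷ c ∷ []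

  ends⊆vertices : ∀ {e} T → e ∈ edges T → ends e ⊆ vertices T
  ends⊆vertices (triangle a b c _ _) (here refl) (here refl)                         = here refl
  ends⊆vertices (triangle a b c _ _) (here refl) (there (here refl))                 = there (here refl)
  ends⊆vertices (triangle a b c _ _) (there (here refl)) (here refl)                 = here refl
  ends⊆vertices (triangle a b c _ _) (there (here refl)) (there (here refl))         = there (there (here refl))
  ends⊆vertices (triangle a b c _ _) (there (there (here refl))) (here refl)         = there (here refl)
  ends⊆vertices (triangle a b c _ _) (there (there (here refl))) (there (here refl)) = there (there (here refl))

  -- Of the nine positions of `i < j` among `a < b < c`, only three are increasing. The order proofs
  -- are irrelevant, so the other six are refuted by `⊥-elim-irr`.
  edge-∈ : ∀ e T → ends e ⊆ vertices T → e ∈ edges T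
  edge-∈ (edge i j i<j) (triangle a b c a<b b<c) e⊆T
    with e⊆T (here refl) | e⊆T (there (here refl))
  ... | here refl                 | here refl                 = ⊥-elim-irr (Fin.<-irrefl refl i<j)
  ... | here refl                 | there (here refl)         = here refl
  ... | here refl                 | there (there (here refl)) = there (here refl)
  ... | there (here refl)         | here refl                 = ⊥-elim-irr (Fin.<-asym a<b i<j)
  ... | there (here refl)         | there (here refl)         = ⊥-elim-irr (Fin.<-irrefl refl i<j)
  ... | there (here refl)         | there (there (here refl)) = there (there (here refl))
  ... | there (there (here refl)) | here refl                 = ⊥-elim-irr (Fin.<-asym (Fin.<-trans a<b b<c) i<j)
  ... | there (there (here refl)) | there (here refl)         = ⊥-elim-irr (Fin.<-asym b<c i<j)
  ... | there (there (here refl)) | there (there (here refl)) = ⊥-elim-irr (Fin.<-irrefl refl i<j)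

  ends-⊆⇒≡ : ∀ e f → ends f ⊆ ends e → f ≡ e
  ends-⊆⇒≡ (edge i j i<j) (edge k l k<l) f⊆e with f⊆e (here refl) | f⊆e (there (here refl))
  ... | here refl         | here refl         = ⊥-elim-irr (Fin.<-irrefl refl k<l)
  ... | here refl         | there (here refl) = refl
  ... | there (here refl) | here refl         = ⊥-elim-irr (Fin.<-asym i<j k<l)
  ... | there (here refl) | there (here refl) = ⊥-elim-irr (Fin.<-irrefl refl k<l)

  vertices-⊆⇒≡ : ∀ S T → vertices S ⊆ vertices T → S ≡ T
  vertices-⊆⇒≡ (triangle a b c a<b b<c) (triangle d e f d<e e<f) S⊆T
    with S⊆T (here refl) | S⊆T (there (here refl)) | S⊆T (there (there (here refl)))
  ... | here refl | there (here refl) | there (there (here refl)) = refl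
  ... | here refl | here refl | _ = ⊥-elim-irr (Fin.<-irrefl refl a<b)
  ... | there (here refl) | here refl | _ = ⊥-elim-irr (Fin.<-asym a<b d<e)
  ... | there (there (here refl)) | here refl | _ = ⊥-elim-irr (Fin.<-asym a<b (Fin.<-trans d<e e<f))
  ... | _ | there (there (here refl)) | here refl = ⊥-elim-irr (Fin.<-asym b<c (Fin.<-trans d<e e<f))
  ... | _ | there (there (here refl)) | there (here refl) = ⊥-elim-irr (Fin.<-asym b<c e<f)
  ... | _ | there (there (here refl)) | there (there (here refl)) = ⊥-elim-irr (Fin.<-irrefl refl b<c)
  ... | _ | there (here refl) | here refl = ⊥-elim-irr (Fin.<-asym b<c d<e)
  ... | _ | there (here refl) | there (here refl) = ⊥-elim-irr (Fin.<-irrefl refl b<c)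
  ... | there (here refl) | there (here refl) | _ = ⊥-elim-irr (Fin.<-irrefl refl a<b)
  ... | there (there (here refl)) | there (here refl) | _ = ⊥-elim-irr (Fin.<-asym a<b e<f)

  -- The vertex of `T` opposite its edge `e`, described so that later arguments need not distinguish
  -- the position of `e` in the triangle.
  record Apex (e : Edge n) (T : Triangle n) (t : Fin n) : Set where
    field
      t∈T   : t ∈ vertices T
      t∉e   : t ∉ ends e
      split : ∀ {v} → v ∈ vertices T → v ∈ ends e ⊎ v ≡ t
  open Apex

  apex : ∀ {e} T → e ∈ edges T → ∃ (Apex e T)
  apex (triangle a b c a<b b<c) (here refl) = c , record
    { t∈T = there (there (here refl))
    ; t∉e = λ { (here refl) → ⊥-elim-irr (Fin.<-asym a<b b<c)
              ; (there (here refl)) → ⊥-elim-irr (Fin.<-irrefl refl b<c) }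
    ; split = λ { (here p) → inj₁ (here p) ; (there (here p)) → inj₁ (there (here p))
                ; (there (there (here p))) → inj₂ p } }
  apex (triangle a b c a<b b<c) (there (here refl)) = b , record
    { t∈T = there (here refl)
    ; t∉e = λ { (here refl) → ⊥-elim-irr (Fin.<-irrefl refl a<b)
              ; (there (here refl)) → ⊥-elim-irr (Fin.<-irrefl refl b<c) }
    ; split = λ { (here p) → inj₁ (here p) ; (there (here p)) → inj₂ p
                ; (there (there (here p))) → inj₁ (there (here p)) } }
  apex (triangle a b c a<b b<c) (there (there (here refl))) = a , record
    { t∈T = here refl
    ; t∉e = λ { (here refl) → ⊥-elim-irr (Fin.<-irrefl refl a<b)
              ; (there (here refl)) → ⊥-elim-irr (Fin.<-asym a<b b<c) }
    ; split = λ { (here p) → inj₂ p ; (there (here p)) → inj₁ (here p)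
                ; (there (there (here p))) → inj₁ (there (here p)) } }

  -- Were `t` not an end of `f`, both ends of `f` would be ends of `e`.
  apex∈other : ∀ {e f T t} → Apex e T t → f ∈ edges T → f ≢ e → t ∈ ends f
  apex∈other {e} {f} {T} {t} A f∈T f≢e with t ∈ᵥ? ends f
  ... | yes t∈f = t∈f
  ... | no t∉f  = contradiction (ends-⊆⇒≡ e f f⊆e) f≢e
    where
    f⊆e : ends f ⊆ ends e
    f⊆e v∈f with split A (ends⊆vertices T f∈T v∈f)
    ... | inj₁ v∈e  = v∈e
    ... | inj₂ refl = contradiction v∈f t∉f

  ∃-end-≢ : ∀ e (t : Fin n) → ∃ λ v → v ∈ ends e × v ≢ t
  ∃-end-≢ (edge i j i<j) t with i Fin.≟ t
  ... | no i≢t   = i , here refl , i≢t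
  ... | yes refl = j , there (here refl) , λ { refl → ⊥-elim-irr (Fin.<-irrefl refl i<j) }

  join : ∀ {t x : Fin n} → t ≢ x → ∃ λ e → ∀ {v} → v ∈ ends e → v ≡ t ⊎ v ≡ x
  join {t} {x} t≢x with Fin.<-cmp t x
  ... | tri< t<x _ _ = edge t x t<x , λ { (here p) → inj₁ p ; (there (here p)) → inj₂ p }
  ... | tri≈ _ t≡x _ = contradiction t≡x t≢x
  ... | tri> _ _ x<t = edge x t x<t , λ { (here p) → inj₂ p ; (there (here p)) → inj₁ p }

  -- e joins t to an end v of r, so x ≢ y would give K the four vertices t, x, y, v.
  apexes-collide : ∀ {r K T N L t x y e} → Apex r T t → Apex r N x → Apex r L y →
    e ∈ edges K → e ∈ edges T → e ≢ r → x ∈ vertices K → y ∈ vertices K →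
    t ≢ x → t ≢ y → x ≡ y
  apexes-collide {r} {K} {T} {N} {L} {t} {x} {y} {e} At Ax Ay e∈K e∈T e≢r x∈K y∈K t≢x t≢y
    with x Fin.≟ y
  ... | yes x≡y = x≡y
  ... | no x≢y with ∃-end-≢ e t
  ...   | v , v∈e , v≢t = contradiction (Unique-⊆⇒length≤ unique ⊆K) λ { (s≤s (s≤s (s≤s ()))) }
    where
    v∈r : v ∈ ends r
    v∈r = [ id , (λ v≡t → contradiction v≡t v≢t) ]′ (split At (ends⊆vertices T e∈T v∈e))
    ∉r⇒≢v : ∀ {z} → z ∉ ends r → z ≢ v
    ∉r⇒≢v z∉r refl = z∉r v∈r
    unique : Unique (t ∷ x ∷ y ∷ v ∷ [])
    unique = (t≢x ∷ t≢y ∷ ∉r⇒≢v (t∉e At) ∷ []) ∷ (x≢y ∷ ∉r⇒≢v (t∉e Ax) ∷ [])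
           ∷ (∉r⇒≢v (t∉e Ay) ∷ []) ∷ [] ∷ []
    ⊆K : t ∷ x ∷ y ∷ v ∷ [] ⊆ vertices K
    ⊆K (here refl) = ends⊆vertices K e∈K (apex∈other At e∈T e≢r)
    ⊆K (there (here refl)) = x∈K
    ⊆K (there (there (here refl))) = y∈K
    ⊆K (there (there (there (here refl)))) = ends⊆vertices K e∈K v∈e

  apex-∈⇒vertices-⊆ : ∀ {r t M} T → Apex r T t → r ∈ edges M → t ∈ vertices M →
                  vertices T ⊆ vertices M
  apex-∈⇒vertices-⊆ {M = M} T A r∈M t∈M v∈T with split A v∈T
  ... | inj₁ v∈r  = ends⊆vertices M r∈M v∈r
  ... | inj₂ refl = t∈M

  -- Transversals, packings and exchanges.

  Meets : Triangle n → Pred (List (Edge n)) 0ℓ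
  Meets K X = Any (_∈ X) (edges K)

  meets? : ∀ K X → Dec (Meets K X)
  meets? K X = any? (_∈ₑ? X) (edges K)

  ¬Meets⇒Disjoint : ∀ {S T} → ¬ Meets S (edges T) → Disjoint (edges S) (edges T)
  ¬Meets⇒Disjoint ¬meets (e∈S , e∈T) = ¬meets (lose e∈S e∈T)

  -- Repeated entries are harmless: the deduplication that `Transversal` calls for does not lengthen
  -- the list.
  τ-least : {F : Family n} (F? : Decidable F) → ∀ X → (∀ T → F T → Meets T X) → τ F F? ℕ.≤ length X
  τ-least F? X hits = ℕ.≤-trans
    (proj₂ (τ-isMin _ F?) (deduplicate _≟ₑ_ X)
      (UniqueDec.deduplicate-! _≟ₑ_ X , λ T FT → Any.map (∈-deduplicate⁺ _≟ₑ_) (hits T FT)))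
    (length-deduplicate _≟ₑ_ X)

  module _ {F : Family n} where

    packing-Unique : ∀ {P} → Packing F P → Unique P
    packing-Unique (_ , disjoint) =
      AllPairs.map (λ { {triangle _ _ _ _ _} d refl → d (here refl , here refl) }) disjoint

    packing-≡ : ∀ {P} → Packing F P → ∀ {S T e} → S ∈ P → T ∈ P → e ∈ edges S → e ∈ edges T → S ≡ T
    packing-≡ (_ , disjoint) S∈P T∈P e∈S e∈T with AllPairs-lookup disjoint S∈P T∈P
    ... | inj₁ S≡T      = S≡T
    ... | inj₂ (inj₁ d) = contradiction (e∈S , e∈T) d
    ... | inj₂ (inj₂ d) = contradiction (e∈T , e∈S) d

    -- Removing the members of `P` listed in `Ys` leaves `P₀`, which is edge-disjoint from `R`; so
    -- `R ++ P₀` is a packing and cannot be longer than `P`. Contradictions with maximality come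
    -- from an `R` longer than `Ys`.
    exchange : ∀ {P R} → MaximumPacking F P → Packing F R → ∀ Ys →
      (∀ {S T} → S ∈ P → T ∈ R → Meets T (edges S) → S ∈ Ys) → length R ℕ.≤ length Ys
    exchange {P} {R} (packP@(allP , disjP) , maximum) (allR , disjR) Ys met⇒∈ =
      ℕ.+-cancelʳ-≤ (length P₀) _ _ (begin
        length R ℕ.+ length P₀   ≡⟨ length-++ R ⟨
        length (R ++ P₀)         ≤⟨ maximum (R ++ P₀) packing ⟩
        length P                 ≤⟨ Unique-⊆⇒length≤ (packing-Unique packP) ⊆Ys++P₀ ⟩
        length (Ys ++ P₀)        ≡⟨ length-++ Ys ⟩
        length Ys ℕ.+ length P₀  ∎)
      where
      open ℕ.≤-Reasoning
      open DecMembership (_≟ₜ_ {n}) using () renaming (_∈?_ to _∈ₜ?_)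
      ∉Ys? = λ S → ¬? (S ∈ₜ? Ys)
      P₀ = filter ∉Ys? P
      packing : Packing F (R ++ P₀)
      packing = All.++⁺ allR (All.filter⁺ ∉Ys? allP) , AllPairs.++⁺ disjR (AllPairs.filter⁺ ∉Ys? disjP)
        (All.tabulate λ T∈R → All.tabulate λ S∈P₀ → ¬Meets⇒Disjoint λ meets →
          let S∈P , S∉Ys = ∈-filter⁻ ∉Ys? {xs = P} S∈P₀ in S∉Ys (met⇒∈ S∈P T∈R meets))
      ⊆Ys++P₀ : P ⊆ Ys ++ P₀
      ⊆Ys++P₀ {S} S∈P with S ∈ₜ? Ys
      ... | yes S∈Ys = ∈-++⁺ˡ S∈Ys
      ... | no S∉Ys  = ∈-++⁺ʳ Ys (∈-filter⁺ ∉Ys? S∈P S∉Ys)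

    maximum⇒maximal : ∀ {P} → MaximumPacking F P → ∀ {K} → F K → ∃ λ T → T ∈ P × Meets K (edges T)
    maximum⇒maximal {P} maxP {K} FK with any? (λ T → meets? K (edges T)) P
    ... | yes met = find met
    ... | no ¬met = contradiction
      (exchange maxP (FK ∷ [] , [] ∷ []) [] λ { S∈P (here refl) meets → contradiction (lose S∈P meets) ¬met })
      λ ()

    -- Double negation suffices, since the packing only serves to prove a decidable inequality. A
    -- packing that is not maximum gives way to a larger one, and `j` bounds how often this can
    -- still happen.
    ¬¬∃MaximumPacking : ∀ k → (∀ P → Packing F P → length P ℕ.≤ k) → ¬ ¬ ∃ (MaximumPacking F)
    ¬¬∃MaximumPacking k bounded ∄max = go k [] ([] , []) (ℕ.m≤m+n k 0)
      where
      go : ∀ j P → Packing F P → k ℕ.≤ j ℕ.+ length P → ⊥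
      go zero    P packP k≤ = ∄max (P , packP , λ P′ packP′ → ℕ.≤-trans (bounded P′ packP′) k≤)
      go (suc j) P packP k≤ = ∄max (P , packP , λ P′ packP′ → ℕ.≮⇒≥ λ P<P′ →
        go j P′ packP′ (ℕ.≤-trans k≤ (ℕ.≤-trans (ℕ.≤-reflexive (sym (ℕ.+-suc j _))) (ℕ.+-monoʳ-≤ j P<P′))))

  -- Colours, private red edges and deletion.

  module _ {H : ColouredGraph n} where

    Red⇒¬Blue : ∀ {e} → Red H e → ¬ Blue H e
    Red⇒¬Blue r b with trans (sym r) b
    ... | ()

    IsEdge⇒coloured : ∀ {e} → IsEdge H e → Red H e ⊎ Blue H e
    IsEdge⇒coloured {e} is with H e
    ... | just red  = inj₁ refl
    ... | just blue = inj₂ refl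

    coloured : ∀ {T e} → 𝓕 H T → e ∈ edges T → Red H e ⊎ Blue H e
    coloured (are , _) e∈T = IsEdge⇒coloured (All.lookup are e∈T)

    red-edge : ∀ {T} → 𝓕 H T →
      ∃ λ r → r ∈ edges T × Red H r × (∀ {e} → e ∈ edges T → Red H e → e ≡ r)
    red-edge {T} (_ , one) = filter-singleton (Red? H) (edges T) one

    red-unique : ∀ {T d e} → 𝓕 H T → d ∈ edges T → e ∈ edges T → Red H d → Red H e → d ≡ e
    red-unique FT d∈T e∈T d-red e-red with red-edge FT
    ... | _ , _ , _ , only = trans (only d∈T d-red) (sym (only e∈T e-red))

    ≢red⇒Blue : ∀ {T r e} → 𝓕 H T → r ∈ edges T → Red H r → e ∈ edges T → e ≢ r → Blue H e
    ≢red⇒Blue FT r∈T r-red e∈T e≢r with coloured FT e∈T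
    ... | inj₁ e-red  = contradiction (red-unique FT e∈T r∈T e-red r-red) e≢r
    ... | inj₂ e-blue = e-blue

    two-blue : ∀ {T} → 𝓕 H T → length (filter (Blue? H) (edges T)) ≡ 2
    two-blue {T@(triangle _ _ _ _ _)} (are , one) = ℕ.suc-injective
      (subst (λ k → k ℕ.+ length (filter (Blue? H) (edges T)) ≡ 3) one (red+blue (edges T) are))
      where
      red+blue : ∀ xs → All (IsEdge H) xs →
        length (filter (Red? H) xs) ℕ.+ length (filter (Blue? H) xs) ≡ length xs
      red+blue []       []         = refl
      red+blue (x ∷ xs) (is ∷ are) with H x
      ... | just red  = cong suc (red+blue xs are)
      ... | just blue = trans (ℕ.+-suc _ _) (cong suc (red+blue xs are))

    blue-edge : ∀ {T} → 𝓕 H T → ∃ λ b → b ∈ edges T × Blue H b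
    blue-edge {T} FT with filter (Blue? H) (edges T) in eq | two-blue FT
    ... | b ∷ _ | _ = b , ∈-filter⁻ (Blue? H) {xs = edges T} (subst (b ∈_) (sym eq) (here refl))

    ∈-blues : ∀ {T e} → e ∈ edges T → Blue H e → e ∈ filter (Blue? H) (edges T)
    ∈-blues = ∈-filter⁺ (Blue? H)

    two-blues-only : ∀ {T d e f} → 𝓕 H T → d ∈ edges T → e ∈ edges T → f ∈ edges T →
      Blue H d → Blue H e → Blue H f → d ≢ e → f ≡ d ⊎ f ≡ e
    two-blues-only {T} {d} {e} {f} FT d∈T e∈T f∈T d-blue e-blue f-blue d≢e with f ≟ₑ d | f ≟ₑ e
    ... | yes f≡d | _       = inj₁ f≡d
    ... | no _    | yes f≡e = inj₂ f≡e
    ... | no f≢d  | no f≢e  = contradiction (ℕ.≤-trans (Unique-⊆⇒length≤ unique ⊆blues)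
                                (ℕ.≤-reflexive (two-blue FT))) λ { (s≤s (s≤s ())) }
      where
      unique : Unique (f ∷ d ∷ e ∷ [])
      unique = (f≢d ∷ f≢e ∷ []) ∷ (d≢e ∷ []) ∷ [] ∷ []
      ⊆blues : f ∷ d ∷ e ∷ [] ⊆ filter (Blue? H) (edges T)
      ⊆blues (here refl)                 = ∈-blues f∈T f-blue
      ⊆blues (there (here refl))         = ∈-blues d∈T d-blue
      ⊆blues (there (there (here refl))) = ∈-blues e∈T e-blue

    PrivateRed⇒only : ∀ {S T e} → 𝓕 H T → PrivateRed H T → 𝓕 H S →
      e ∈ edges S → e ∈ edges T → Red H e → S ≡ T
    PrivateRed⇒only FT private-red FS e∈S e∈T e-red with find private-red
    ... | d , d∈T , d-red , U , _ , only with red-unique FT e∈T d∈T e-red d-red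
    ...   | refl = trans (sym (only (FS , e∈S))) (only (FT , e∈T))

    ¬PrivateRed⇒another : ∀ {T e} → 𝓕 H T → ¬ PrivateRed H T → e ∈ edges T → Red H e →
      ∃ λ S → 𝓕 H S × e ∈ edges S × S ≢ T
    ¬PrivateRed⇒another {T} {e} FT ¬private e∈T e-red
      with ∃Triangle? (λ S → 𝓕? H S ×-dec (e ∈ₑ? edges S) ×-dec ¬? (S ≟ₜ T))
    ... | yes found = found
    ... | no ∄ = contradiction (lose e∈T (e-red , T , (FT , e∈T) ,
        λ { {S} (FS , e∈S) → sym (decidable-stable (S ≟ₜ T) λ S≢T → ∄ (S , FS , e∈S , S≢T)) }))
      ¬private

    ∉⇒∖≡ : ∀ {X e} → e ∉ X → (H ∖ X) e ≡ H e
    ∉⇒∖≡ {X} {e} e∉X with e ∈ₑ? X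
    ... | yes e∈X = contradiction e∈X e∉X
    ... | no _    = refl

    IsEdge-∖⇒∉ : ∀ {X e} → IsEdge (H ∖ X) e → e ∉ X
    IsEdge-∖⇒∉ {X} {e} is with e ∈ₑ? X
    ... | no e∉X = e∉X
    IsEdge-∖⇒∉ {X} {e} () | yes _

  𝓕-resp : ∀ {G H : ColouredGraph n} {T} → (∀ {e} → e ∈ edges T → G e ≡ H e) → 𝓕 G T → 𝓕 H T
  𝓕-resp {G} {H} {T} G≡H (are , one) =
    All.tabulate (λ e∈T → subst Is-just (G≡H e∈T) (All.lookup are e∈T)) ,
    trans (cong length (sym (same-reds (edges T) G≡H))) one
    where
    same-reds : ∀ xs → (∀ {e} → e ∈ xs → G e ≡ H e) → filter (Red? G) xs ≡ filter (Red? H) xs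
    same-reds []       G≡H = refl
    same-reds (x ∷ xs) G≡H with G x | H x | G≡H (here refl)
    ... | just red  | _ | refl = cong (x ∷_) (same-reds xs (G≡H ∘ there))
    ... | just blue | _ | refl = same-reds xs (G≡H ∘ there)
    ... | nothing   | _ | refl = same-reds xs (G≡H ∘ there)

  𝓕-∖⁺ : ∀ {H X T} → 𝓕 H T → ¬ Meets T X → 𝓕 (H ∖ X) T
  𝓕-∖⁺ {H} FT ¬meets = 𝓕-resp (λ e∈T → sym (∉⇒∖≡ {H} λ e∈X → ¬meets (lose e∈T e∈X))) FT

  𝓕-∖⁻-∉ : ∀ {H X T e} → 𝓕 (H ∖ X) T → e ∈ edges T → e ∉ X
  𝓕-∖⁻-∉ {H} (are , _) e∈T = IsEdge-∖⇒∉ {H} (All.lookup are e∈T)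

  𝓕-∖⁻ : ∀ {H X T} → 𝓕 (H ∖ X) T → 𝓕 H T
  𝓕-∖⁻ {H} {X} {T} FT = 𝓕-resp (λ e∈T → ∉⇒∖≡ {H} (𝓕-∖⁻-∉ {H} {X} {T} FT e∈T)) FT

  ∈-B : ∀ {H : ColouredGraph n} {P T e} → T ∈ P → e ∈ edges T → Blue H e → e ∈ B H P
  ∈-B {H} T∈P e∈T = ∈-filter⁺ (Blue? H) (∈-concatMap⁺ edges (lose T∈P e∈T))

  length-B : ∀ {H : ColouredGraph n} {P} → All (𝓕 H) P → length (B H P) ≡ length P ℕ.* 2
  length-B {H} [] = refl
  length-B {H} {T ∷ P} (FT ∷ FP)
    rewrite filter-++ (Blue? H) (edges T) (concatMap edges P)
          | length-++ (filter (Blue? H) (edges T)) {B H P} = cong₂ ℕ._+_ (two-blue FT) (length-B FP)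

  -- Local covers built with the help of a second packing.

  module _ (H : ColouredGraph n) {P Q : List (Triangle n)}
           (maxP : MaximumPacking (𝓕 H) P) (packQ : Packing (𝓕[ H ]after P) Q)
           (private? : Decidable (PrivateRed (H ∖ B H P))) where

    private
      H′ : ColouredGraph n
      H′ = H ∖ B H P

      packP : Packing (𝓕 H) P
      packP = proj₁ maxP

      ∈P⇒𝓕 : ∀ {T} → T ∈ P → 𝓕 H T
      ∈P⇒𝓕 = All.lookup (proj₁ packP)

      ∈Q⇒𝓕 : ∀ {N} → N ∈ Q → 𝓕 H′ N
      ∈Q⇒𝓕 = All.lookup (proj₁ packQ)

      ∉B : ∀ {N e} → 𝓕 H′ N → e ∈ edges N → e ∉ B H P
      ∉B {N} = 𝓕-∖⁻-∉ {H = H} {B H P} {N}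

      𝓕′⇒𝓕 : ∀ {N} → 𝓕 H′ N → 𝓕 H N
      𝓕′⇒𝓕 {N} = 𝓕-∖⁻ {H = H} {B H P} {N}

    -- The blue edges of `T` are absent from `H′`.
    shared⇒Red : ∀ {N T e} → 𝓕 H′ N → T ∈ P → e ∈ edges N → e ∈ edges T → Red H e
    shared⇒Red FN T∈P e∈N e∈T with coloured (∈P⇒𝓕 T∈P) e∈T
    ... | inj₁ e-red  = e-red
    ... | inj₂ e-blue = contradiction (∈-B {H = H} T∈P e∈T e-blue) (∉B FN e∈N)

    -- By `shared⇒Red`, `N` shares only its unique red edge with members of `P`, and that edge lies
    -- in at most one of them.
    meets-one : ∀ {N S T} → 𝓕 H′ N → S ∈ P → T ∈ P →
      Meets N (edges S) → Meets N (edges T) → S ≡ T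
    meets-one FN S∈P T∈P meetsS meetsT with find meetsS | find meetsT
    ... | d , d∈N , d∈S | e , e∈N , e∈T
      with red-unique (𝓕′⇒𝓕 FN) d∈N e∈N (shared⇒Red FN S∈P d∈N d∈S) (shared⇒Red FN T∈P e∈N e∈T)
    ...   | refl = packing-≡ packP S∈P T∈P d∈S e∈T

    -- Dually, members of `Q` reach `T` only through its red edge, which lies in at most one of
    -- them.
    met-by-one : ∀ {M N T} → T ∈ P → M ∈ Q → N ∈ Q → Meets M (edges T) → Meets N (edges T) → M ≡ N
    met-by-one T∈P M∈Q N∈Q meetsM meetsN with find meetsM | find meetsN
    ... | d , d∈M , d∈T | e , e∈N , e∈T
      with red-unique (∈P⇒𝓕 T∈P) d∈T e∈T
             (shared⇒Red (∈Q⇒𝓕 M∈Q) T∈P d∈M d∈T) (shared⇒Red (∈Q⇒𝓕 N∈Q) T∈P e∈N e∈T)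
    ...   | refl = packing-≡ packQ M∈Q N∈Q d∈M e∈N

    -- The only way in which a triangle `K` meeting `T` may escape the cover of `T`: they share blue
    -- edges only, `T` is met by `Q`, and `K` meets a further member of `P`. The negated last clause
    -- is what a proof by contradiction yields.
    Blocked : Triangle n → Pred (Triangle n) 0ℓ
    Blocked K T = (∀ {e} → e ∈ edges K → e ∈ edges T → Blue H e)
                × (∃ λ N → N ∈ Q × Meets N (edges T))
                × ¬ (∀ {S} → S ∈ P → Meets K (edges S) → S ≡ T)

    CoversUnlessBlocked : Triangle n → Pred (List (Edge n)) 0ℓ
    CoversUnlessBlocked T X = ∀ {K} → 𝓕 H K → Meets K (edges T) → ¬ Meets K X → Blocked K T

    CoversUnlessBlocked-mono : ∀ {T X Y} → X ⊆ Y → CoversUnlessBlocked T X → CoversUnlessBlocked T Y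
    CoversUnlessBlocked-mono X⊆Y covers FK meets ¬meetsY = covers FK meets (¬meetsY ∘ Any.map X⊆Y)

    -- Otherwise `M` would contain all vertices of `T`, and with them a blue edge of `T`, which `H′`
    -- lacks.
    apex-∉ : ∀ {M T r t} → T ∈ P → Apex r T t → 𝓕 H′ M → r ∈ edges M → t ∉ vertices M
    apex-∉ {M} {T} T∈P A FM r∈M t∈M with blue-edge (∈P⇒𝓕 T∈P)
    ... | b , b∈T , b-blue = ∉B FM
      (edge-∈ b M (apex-∈⇒vertices-⊆ {M = M} T A r∈M t∈M ∘ ends⊆vertices T b∈T))
      (∈-B {H = H} T∈P b∈T b-blue)

    -- Otherwise T could be exchanged for K and M.
    apex-∈ : ∀ {K M T r x} → T ∈ P → r ∈ edges T → 𝓕 H K →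
      (∀ {S} → S ∈ P → Meets K (edges S) → S ≡ T) → r ∉ edges K →
      𝓕 H′ M → r ∈ edges M → Apex r M x → x ∈ vertices K
    apex-∈ {K} {M} {T} T∈P r∈T FK onlyT r∉K FM r∈M A with meets? K (edges M)
    ... | no ¬meets = contradiction
      (exchange maxP (FK ∷ 𝓕′⇒𝓕 FM ∷ [] , (¬Meets⇒Disjoint {S = K} {M} ¬meets ∷ []) ∷ [] ∷ []) (T ∷ [])
        λ { S∈P (here refl) meetsS         → here (onlyT S∈P meetsS)
          ; S∈P (there (here refl)) meetsS → here (meets-one FM S∈P T∈P meetsS (lose r∈M r∈T)) })
      λ { (s≤s ()) }
    ... | yes meets with find meets
    ...   | f , f∈K , f∈M = ends⊆vertices K f∈K (apex∈other A f∈M λ { refl → r∉K f∈K })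

    -- The number of edges, out of three, saved at the member of `P` that `N` meets; over all of `Q`
    -- the weights add up to 2q - u′.
    weight : Triangle n → ℕ
    weight N = 2 ℕ.∸ ⟦ private? N ⟧

    -- If K escapes the red edge r of T and meets no other member of P, it contains the
    -- apexes over r of T, of N and of every other member of 𝓕 H′ on r.
    matched-cover : ∀ {T N} → T ∈ P → N ∈ Q → Meets N (edges T) →
      ∃ λ C → length C ℕ.+ weight N ℕ.≤ 3 × CoversUnlessBlocked T C
    matched-cover {T} {N} T∈P N∈Q meetsT with find meetsT
    ... | r , r∈N , r∈T with apex T r∈T | apex N r∈N
    ...   | t , At | x , Ax = choose (private? N)
      where
      FN : 𝓕 H′ N
      FN = ∈Q⇒𝓕 N∈Q
      r-red : Red H r
      r-red = shared⇒Red FN T∈P r∈N r∈T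
      r-red′ : Red H′ r
      r-red′ = trans (∉⇒∖≡ {H = H} (∉B FN r∈N)) r-red
      t≢apex : ∀ {M y} → 𝓕 H′ M → r ∈ edges M → Apex r M y → t ≢ y
      t≢apex FM r∈M Ay refl = apex-∉ T∈P At FM r∈M (Apex.t∈T Ay)

      module _ {K : Triangle n} (FK : 𝓕 H K) (meets : Meets K (edges T)) (r∉K : r ∉ edges K) where
        blue-on-T : ∀ {e} → e ∈ edges K → e ∈ edges T → Blue H e
        blue-on-T e∈K e∈T = ≢red⇒Blue (∈P⇒𝓕 T∈P) r∈T r-red e∈T λ { refl → r∉K e∈K }
        blocked : ¬ (∀ {S} → S ∈ P → Meets K (edges S) → S ≡ T) → Blocked K T
        blocked ¬onlyT = blue-on-T , (N , N∈Q , meetsT) , ¬onlyT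
        t∈K : t ∈ vertices K
        t∈K with find meets
        ... | e , e∈K , e∈T = ends⊆vertices K e∈K (apex∈other At e∈T λ { refl → r∉K e∈K })

      choose : (priv? : Dec (PrivateRed H′ N)) →
        ∃ λ C → length C ℕ.+ (2 ℕ.∸ ⟦ priv? ⟧) ℕ.≤ 3 × CoversUnlessBlocked T C
      -- Here `weight N` is 1, so two edges are affordable. Besides `r` one takes `g`, which joins
      -- `t` and `x`; a `K` that meets `T` but no other member of `P`, and avoids `r`, contains
      -- both.
      choose (yes _) with join (t≢apex FN r∈N Ax)
      ... | g , g⊆tx = r ∷ g ∷ [] , ℕ.≤-refl , covers
        where
        covers : CoversUnlessBlocked T (r ∷ g ∷ [])
        covers {K} FK meets ¬meetsC = blocked FK meets r∉K λ onlyT →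
          let x∈K = apex-∈ T∈P r∈T FK onlyT r∉K FN r∈N Ax
              g∈K = edge-∈ g K λ v∈g →
                [ (λ { refl → t∈K FK meets r∉K }) , (λ { refl → x∈K }) ]′ (g⊆tx v∈g)
          in ¬meetsC (lose g∈K (there (here refl)))
          where
          r∉K : r ∉ edges K
          r∉K r∈K = ¬meetsC (lose r∈K (here refl))
      -- Here `weight N` is 2, so only `r` is affordable. A second triangle `L` on `r` replaces `g`:
      -- such a `K` would contain `t`, `x` and `y`, forcing `x ≡ y` and hence `L ≡ N`.
      choose (no ¬private) with ¬PrivateRed⇒another {H = H′} FN ¬private r∈N r-red′
      ... | L , FL , r∈L , L≢N with apex L r∈L
      ...   | y , Ay = r ∷ [] , ℕ.≤-refl , covers
        where
        covers : CoversUnlessBlocked T (r ∷ [])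
        covers {K} FK meets ¬meetsC = blocked FK meets r∉K λ onlyT →
          let e , e∈K , e∈T = find meets
              inside : ∀ {M z} → 𝓕 H′ M → r ∈ edges M → Apex r M z → z ∈ vertices K
              inside = apex-∈ T∈P r∈T FK onlyT r∉K
              x≡y = apexes-collide {K = K} At Ax Ay e∈K e∈T (λ { refl → r∉K e∈K })
                      (inside FN r∈N Ax) (inside FL r∈L Ay) (t≢apex FN r∈N Ax) (t≢apex FL r∈L Ay)
          in L≢N (vertices-⊆⇒≡ L N
               (apex-∈⇒vertices-⊆ {M = N} L Ay r∈N (subst (_∈ vertices N) x≡y (Apex.t∈T Ax))))
          where
          r∉K : r ∉ edges K
          r∉K r∈K = ¬meetsC (lose r∈K (here refl))

    charge : Triangle n → Triangle n → ℕ
    charge T N = ⟦ meets? N (edges T) ⟧ ℕ.* weight N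

    -- The saving, against the three edges of T, that a local cover of T has to achieve.
    demand : Triangle n → ℕ
    demand T = ⟦ PrivateRed? H T ⟧ ℕ.+ ∑ Q (charge T)

    -- The shared edge is the private red edge of `T`, so `N` would be `T` itself, whose blue edges
    -- are absent from `H′`.
    private-unmet : ∀ {N T} → T ∈ P → PrivateRed H T → N ∈ Q → ¬ Meets N (edges T)
    private-unmet {N} {T} T∈P priv N∈Q meets =
      let r , r∈N , r∈T = find meets
          b , b∈T , b-blue = blue-edge (∈P⇒𝓕 T∈P)
          FN = ∈Q⇒𝓕 N∈Q
          N≡T = PrivateRed⇒only (∈P⇒𝓕 T∈P) priv (𝓕′⇒𝓕 FN) r∈N r∈T (shared⇒Red FN T∈P r∈N r∈T)
      in ∉B FN (subst (λ S → b ∈ edges S) (sym N≡T) b∈T) (∈-B {H = H} T∈P b∈T b-blue)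

    -- A `K` containing the red edge of `T` is `T` itself, so every `K` that meets `T` contains a
    -- blue edge of `T`.
    private-cover : ∀ {T} → T ∈ P → PrivateRed H T → CoversUnlessBlocked T (filter (Blue? H) (edges T))
    private-cover {T} T∈P priv FK meets ¬meetsBlues with find meets
    ... | e , e∈K , e∈T with coloured (∈P⇒𝓕 T∈P) e∈T
    ...   | inj₂ e-blue = contradiction (lose e∈K (∈-blues {H = H} {T} e∈T e-blue)) ¬meetsBlues
    ...   | inj₁ e-red with PrivateRed⇒only (∈P⇒𝓕 T∈P) priv FK e∈K e∈T e-red
    ...     | refl = let b , b∈T , b-blue = blue-edge FK in
                     contradiction (lose b∈T (∈-blues {H = H} {T} b∈T b-blue)) ¬meetsBlues

    -- By `private-unmet`, the saving for a private red edge and the saving for a member of `Q` are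
    -- never demanded of the same `T`.
    local-cover : ∀ {T} → T ∈ P → ∃ λ C → length C ℕ.+ demand T ℕ.≤ 3 × CoversUnlessBlocked T C
    local-cover {T} T∈P = choose (PrivateRed? H T)
      (∑-indicator (λ N → meets? N (edges T)) weight (packing-Unique packQ) (met-by-one T∈P))
      where
      -- The sum over `Q` is generalised to `s`, so that both case distinctions become plain
      -- matching.
      choose : ∀ {s} (priv? : Dec (PrivateRed H T)) →
        All (λ N → ¬ Meets N (edges T)) Q × s ≡ 0 ⊎ (∃ λ N → N ∈ Q × Meets N (edges T) × s ≡ weight N) →
        ∃ λ C → length C ℕ.+ (⟦ priv? ⟧ ℕ.+ s) ℕ.≤ 3 × CoversUnlessBlocked T C
      choose (no _) (inj₁ (_ , refl)) =
        edges T , ℕ.≤-refl , λ _ meets ¬meets → contradiction meets ¬meets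
      choose (no _) (inj₂ (N , N∈Q , meets , refl)) = matched-cover T∈P N∈Q meets
      choose (yes priv) (inj₁ (_ , refl)) =
        filter (Blue? H) (edges T) , ℕ.≤-reflexive (cong (ℕ._+ 1) (two-blue (∈P⇒𝓕 T∈P))) , private-cover T∈P priv
      choose (yes priv) (inj₂ (N , N∈Q , meets , _)) = contradiction meets (private-unmet T∈P priv N∈Q)

    -- S and T could be exchanged for K and the members of Q meeting S and T.
    not-all-blocked : ∀ {K S T} → 𝓕 H K → S ∈ P → T ∈ P → S ≢ T →
      Meets K (edges S) → Meets K (edges T) →
      ¬ (∀ {U} → U ∈ P → Meets K (edges U) → Blocked K U)
    not-all-blocked {K} {S} {T} FK S∈P T∈P S≢T meetsS meetsT blocked
      with find meetsS | find meetsT | blocked S∈P meetsS | blocked T∈P meetsT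
    ... | d , d∈K , d∈S | e , e∈K , e∈T | blueS , (M , M∈Q , M-meetsS) , _ | blueT , (N , N∈Q , N-meetsT) , _ =
      contradiction (exchange maxP packing (S ∷ T ∷ []) met⇒∈) λ { (s≤s (s≤s ())) }
      where
      d-blue : Blue H d
      d-blue = blueS d∈K d∈S
      e-blue : Blue H e
      e-blue = blueT e∈K e∈T
      blue⇒d⊎e : ∀ {f} → f ∈ edges K → Blue H f → f ≡ d ⊎ f ≡ e
      blue⇒d⊎e f∈K f-blue = two-blues-only FK d∈K e∈K f∈K d-blue e-blue f-blue
        λ { refl → S≢T (packing-≡ packP S∈P T∈P d∈S e∈T) }

      ∉B⇒Red : ∀ {f} → f ∈ edges K → f ∉ B H P → Red H f
      ∉B⇒Red f∈K f∉B with coloured FK f∈K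
      ... | inj₁ f-red = f-red
      ... | inj₂ f-blue with blue⇒d⊎e f∈K f-blue
      ...   | inj₁ refl = contradiction (∈-B {H = H} S∈P d∈S d-blue) f∉B
      ...   | inj₂ refl = contradiction (∈-B {H = H} T∈P e∈T e-blue) f∉B

      -- An edge `f` shared by `K` and `L` is outside `B H P`, so it is red by `∉B⇒Red` and is the
      -- red edge of `L`. That edge lies in `U`, with which `K` shares only blue edges.
      ¬K-meets : ∀ {U L} → U ∈ P → (∀ {f} → f ∈ edges K → f ∈ edges U → Blue H f) →
        L ∈ Q → Meets L (edges U) → ¬ Meets K (edges L)
      ¬K-meets {U} U∈P blueU L∈Q L-meetsU K-meetsL with find K-meetsL | find L-meetsU
      ... | f , f∈K , f∈L | r , r∈L , r∈U
        with red-unique (𝓕′⇒𝓕 FL) r∈L f∈L (shared⇒Red FL U∈P r∈L r∈U) f-red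
        where
        FL = ∈Q⇒𝓕 L∈Q
        f-red : Red H f
        f-red = ∉B⇒Red f∈K (∉B FL f∈L)
      ...   | refl = Red⇒¬Blue {H = H} (∉B⇒Red f∈K (∉B (∈Q⇒𝓕 L∈Q) f∈L)) (blueU f∈K r∈U)

      ¬M-meets-N : ¬ Meets M (edges N)
      ¬M-meets-N meets with find meets
      ... | f , f∈M , f∈N with packing-≡ packQ M∈Q N∈Q f∈M f∈N
      ...   | refl = S≢T (meets-one (∈Q⇒𝓕 M∈Q) S∈P T∈P M-meetsS N-meetsT)

      packing : Packing (𝓕 H) (K ∷ M ∷ N ∷ [])
      packing = FK ∷ 𝓕′⇒𝓕 (∈Q⇒𝓕 M∈Q) ∷ 𝓕′⇒𝓕 (∈Q⇒𝓕 N∈Q) ∷ []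
        , (¬Meets⇒Disjoint {S = K} {M} (¬K-meets S∈P blueS M∈Q M-meetsS)
          ∷ ¬Meets⇒Disjoint {S = K} {N} (¬K-meets T∈P blueT N∈Q N-meetsT) ∷ [])
        ∷ (¬Meets⇒Disjoint {S = M} {N} ¬M-meets-N ∷ []) ∷ [] ∷ []

      -- Every member of `P` met by `K` is blocked, hence met in a blue edge, and `d` and `e` are
      -- the only blue edges of `K`.
      met⇒∈ : ∀ {U L} → U ∈ P → L ∈ K ∷ M ∷ N ∷ [] → Meets L (edges U) → U ∈ S ∷ T ∷ []
      met⇒∈ U∈P (here refl) meetsU with find meetsU
      ... | f , f∈K , f∈U with blue⇒d⊎e f∈K (proj₁ (blocked U∈P meetsU) f∈K f∈U)
      ...   | inj₁ refl = here (packing-≡ packP U∈P S∈P f∈U d∈S)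
      ...   | inj₂ refl = there (here (packing-≡ packP U∈P T∈P f∈U e∈T))
      met⇒∈ U∈P (there (here refl)) meetsU =
        here (meets-one (∈Q⇒𝓕 M∈Q) U∈P S∈P meetsU M-meetsS)
      met⇒∈ U∈P (there (there (here refl))) meetsU =
        there (here (meets-one (∈Q⇒𝓕 N∈Q) U∈P T∈P meetsU N-meetsT))

    -- Suppose `K` escapes `X`. It meets some `T` in `P`; if it meets a second member too,
    -- `not-all-blocked` applies, and otherwise the third clause of `Blocked` fails at `T`.
    unless-blocked⇒covers : ∀ {X} → (∀ {T} → T ∈ P → CoversUnlessBlocked T X) →
      ∀ K → 𝓕 H K → Meets K X
    unless-blocked⇒covers {X} covers K FK = decidable-stable (meets? K X) go
      where
      go : ¬ ¬ Meets K X
      go ¬meetsX with maximum⇒maximal maxP FK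
      ... | T , T∈P , meetsT with any? (λ S → meets? K (edges S) ×-dec ¬? (S ≟ₜ T)) P
      ...   | yes another = let S , S∈P , meetsS , S≢T = find another in
                not-all-blocked FK S∈P T∈P S≢T meetsS meetsT λ U∈P meetsU → covers U∈P FK meetsU ¬meetsX
      ...   | no none = proj₂ (proj₂ (covers T∈P FK meetsT ¬meetsX)) λ {S} S∈P meetsS →
                decidable-stable (S ≟ₜ T) λ S≢T → none (lose S∈P (meetsS , S≢T))

    -- The size of the assembled `X` plus the total demand is at most 3p. Since `P` is maximal, each
    -- `N` in `Q` is charged to some `T`, so the total demand is at least u + (2q - u′).
    matching-bound : τ (𝓕 H) (𝓕? H) ℕ.+ (length (filter (PrivateRed? H) P) ℕ.+ length Q ℕ.* 2)
                     ℕ.≤ length P ℕ.* 3 ℕ.+ length (filter private? Q)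
    matching-bound =
      let X , size , covers = assemble (λ {T} {C} {D} → CoversUnlessBlocked-mono {T} {C} {D})
                                3 demand P local-cover
      in combine (τ-least (𝓕? H) X (unless-blocked⇒covers covers))
           (∑-complement private? Q)
           (∑-double-count (PrivateRed? H) (λ T N → meets? N (edges T)) weight P Q
             λ N∈Q → maximum⇒maximal maxP (𝓕′⇒𝓕 (∈Q⇒𝓕 N∈Q)))
           size
      where
      combine : ∀ {t x u q w u′ d c} → t ℕ.≤ x → w ℕ.+ u′ ≡ q → u ℕ.+ w ℕ.≤ d → x ℕ.+ d ℕ.≤ c →
                t ℕ.+ (u ℕ.+ q) ℕ.≤ c ℕ.+ u′
      combine {t} {x} {u} {w = w} {u′} {d} {c} t≤x refl u+w≤d x+d≤c = begin
        t ℕ.+ (u ℕ.+ (w ℕ.+ u′))  ≤⟨ ℕ.+-monoˡ-≤ _ t≤x ⟩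
        x ℕ.+ (u ℕ.+ (w ℕ.+ u′))  ≡⟨ solve 4 (λ a b c d → a :+ (b :+ (c :+ d)) := a :+ (b :+ c) :+ d) refl x u w u′ ⟩
        x ℕ.+ (u ℕ.+ w) ℕ.+ u′    ≤⟨ ℕ.+-monoˡ-≤ u′ (ℕ.+-monoʳ-≤ x u+w≤d) ⟩
        x ℕ.+ d ℕ.+ u′            ≤⟨ ℕ.+-monoˡ-≤ u′ x+d≤c ⟩
        c ℕ.+ u′                  ∎
        where
        open ℕ.≤-Reasoning
        open +-*-Solver

  -- The integral inequalities and their combination.

  τ-after : ∀ {H : ColouredGraph n} {P} → All (𝓕 H) P →
    τ (𝓕 H) (𝓕? H) ℕ.≤ length P ℕ.* 2 ℕ.+ τ (𝓕[ H ]after P) (𝓕? (H ∖ B H P))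
  τ-after {H} {P} FP =
    let (X , |X|≡τ , _ , X-hits) , _ = τ-isMin (𝓕[ H ]after P) (𝓕? (H ∖ B H P))
    in ℕ.≤-trans
      (τ-least (𝓕? H) (B H P ++ X) λ T FT → hits X X-hits T FT (meets? T (B H P)))
      (ℕ.≤-reflexive (trans (length-++ (B H P)) (cong₂ ℕ._+_ (length-B FP) |X|≡τ)))
    where
    hits : ∀ X → (∀ T → 𝓕 (H ∖ B H P) T → Meets T X) →
      ∀ T → 𝓕 H T → Dec (Meets T (B H P)) → Meets T (B H P ++ X)
    hits X X-hits T FT (yes meets) = Any.map ∈-++⁺ˡ meets
    hits X X-hits T FT (no ¬meets) = Any.map (∈-++⁺ʳ (B H P)) (X-hits T (𝓕-∖⁺ {H = H} FT ¬meets))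

  -- The sum of `τ-after`, of `matching-bound` for `H′` and `Q` with an empty second packing, and of
  -- twice `matching-bound` for `H`, `P` and `Q`. What remains is an excess of u′ - q, which is at
  -- most 0.
  first-bound-ℕ : ∀ {H : ColouredGraph n} {P Q} → MaximumPacking (𝓕 H) P → MaximumPacking (𝓕[ H ]after P) Q →
    3 ℕ.* τ (𝓕 H) (𝓕? H) ℕ.+ 2 ℕ.* length (filter (PrivateRed? H) P) ℕ.≤ 8 ℕ.* length P
  first-bound-ℕ {H} {P} {Q} maxP maxQ = combine
    (τ (𝓕 H) (𝓕? H)) (τ (𝓕 H′) (𝓕? H′)) (length P) (length Q)
    (length (filter (PrivateRed? H) P)) (length (filter (PrivateRed? H′) Q))
    (τ-after (proj₁ (proj₁ maxP)))
    (subst (λ k → τ (𝓕 H′) (𝓕? H′) ℕ.+ (length (filter (PrivateRed? H′) Q) ℕ.+ 0) ℕ.≤ k)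
      (ℕ.+-identityʳ (length Q ℕ.* 3)) (matching-bound H′ maxQ ([] , []) (PrivateRed? _)))
    (matching-bound H maxP (proj₁ maxQ) (PrivateRed? H′))
    (length-filter (PrivateRed? H′) Q)
    where
    H′ : ColouredGraph n
    H′ = H ∖ B H P
    combine : ∀ t s p q u u′ → t ℕ.≤ p ℕ.* 2 ℕ.+ s → s ℕ.+ (u′ ℕ.+ 0) ℕ.≤ q ℕ.* 3 →
      t ℕ.+ (u ℕ.+ q ℕ.* 2) ℕ.≤ p ℕ.* 3 ℕ.+ u′ → u′ ℕ.≤ q → 3 ℕ.* t ℕ.+ 2 ℕ.* u ℕ.≤ 8 ℕ.* p
    combine t s p q u u′ cover rest match u′≤q = ℕ.+-cancelʳ-≤ (s ℕ.+ u′ ℕ.+ 4 ℕ.* q) _ _ (begin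
      3 ℕ.* t ℕ.+ 2 ℕ.* u ℕ.+ (s ℕ.+ u′ ℕ.+ 4 ℕ.* q)
        ≡⟨ solve 5 (λ t s q u u′ → con 3 :* t :+ con 2 :* u :+ (s :+ u′ :+ con 4 :* q)
             := t :+ (s :+ (u′ :+ con 0)) :+ con 2 :* (t :+ (u :+ q :* con 2))) refl t s q u u′ ⟩
      t ℕ.+ (s ℕ.+ (u′ ℕ.+ 0)) ℕ.+ 2 ℕ.* (t ℕ.+ (u ℕ.+ q ℕ.* 2))
        ≤⟨ ℕ.+-mono-≤ (ℕ.+-mono-≤ cover rest) (ℕ.*-monoʳ-≤ 2 match) ⟩
      p ℕ.* 2 ℕ.+ s ℕ.+ q ℕ.* 3 ℕ.+ 2 ℕ.* (p ℕ.* 3 ℕ.+ u′)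
        ≡⟨ solve 4 (λ p s q u′ → p :* con 2 :+ s :+ q :* con 3 :+ con 2 :* (p :* con 3 :+ u′)
             := con 8 :* p :+ (s :+ u′ :+ con 3 :* q) :+ u′) refl p s q u′ ⟩
      8 ℕ.* p ℕ.+ (s ℕ.+ u′ ℕ.+ 3 ℕ.* q) ℕ.+ u′
        ≤⟨ ℕ.+-monoʳ-≤ _ u′≤q ⟩
      8 ℕ.* p ℕ.+ (s ℕ.+ u′ ℕ.+ 3 ℕ.* q) ℕ.+ q
        ≡⟨ solve 4 (λ p s q u′ → con 8 :* p :+ (s :+ u′ :+ con 3 :* q) :+ q
             := con 8 :* p :+ (s :+ u′ :+ con 4 :* q)) refl p s q u′ ⟩
      8 ℕ.* p ℕ.+ (s ℕ.+ u′ ℕ.+ 4 ℕ.* q) ∎)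
      where
      open ℕ.≤-Reasoning
      open +-*-Solver

  -- Three times `τ-after`, plus `first-bound-ℕ` for `H′` and `Q`, plus `matching-bound`; a surplus
  -- u′ on the left is dropped. The middle term requires a maximum packing `R` in the family left
  -- after `Q`.
  second-bound-ℕ : ∀ {H : ColouredGraph n} {P Q} → MaximumPacking (𝓕 H) P → MaximumPacking (𝓕[ H ]after P) Q →
    4 ℕ.* τ (𝓕 H) (𝓕? H) ℕ.+ length (filter (PrivateRed? H) P) ℕ.≤ 9 ℕ.* length P ℕ.+ 6 ℕ.* length Q
  second-bound-ℕ {H} {P} {Q} maxP maxQ =
    decidable-stable (4 ℕ.* t ℕ.+ u ℕ.≤? 9 ℕ.* length P ℕ.+ 6 ℕ.* length Q) λ ¬bound →
      -- A packing in the family left after `Q` is also one in `𝓕 H′`, so `length Q` bounds its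
      -- size.
      ¬¬∃MaximumPacking (length Q)
        (λ { R (allR , disjR) → proj₂ maxQ R (All.map (𝓕-∖⁻ {H = H′} {B H′ Q}) allR , disjR) })
        λ (R , maxR) → ¬bound (combine
          t (τ (𝓕 H′) (𝓕? H′)) (length P) (length Q) u (length (filter (PrivateRed? H′) Q))
          (τ-after (proj₁ (proj₁ maxP))) (first-bound-ℕ maxQ maxR)
          (matching-bound H maxP (proj₁ maxQ) (PrivateRed? H′)))
    where
    H′ : ColouredGraph n
    H′ = H ∖ B H P
    t = τ (𝓕 H) (𝓕? H)
    u = length (filter (PrivateRed? H) P)
    combine : ∀ t s p q u u′ → t ℕ.≤ p ℕ.* 2 ℕ.+ s → 3 ℕ.* s ℕ.+ 2 ℕ.* u′ ℕ.≤ 8 ℕ.* q →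
      t ℕ.+ (u ℕ.+ q ℕ.* 2) ℕ.≤ p ℕ.* 3 ℕ.+ u′ → 4 ℕ.* t ℕ.+ u ℕ.≤ 9 ℕ.* p ℕ.+ 6 ℕ.* q
    combine t s p q u u′ cover rest match =
      ℕ.≤-trans (ℕ.m≤m+n _ u′) (ℕ.+-cancelʳ-≤ (3 ℕ.* s ℕ.+ u′ ℕ.+ 2 ℕ.* q) _ _ (begin
      4 ℕ.* t ℕ.+ u ℕ.+ u′ ℕ.+ (3 ℕ.* s ℕ.+ u′ ℕ.+ 2 ℕ.* q)
        ≡⟨ solve 5 (λ t s q u u′ → con 4 :* t :+ u :+ u′ :+ (con 3 :* s :+ u′ :+ con 2 :* q)
             := con 3 :* t :+ (con 3 :* s :+ con 2 :* u′) :+ (t :+ (u :+ q :* con 2))) refl t s q u u′ ⟩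
      3 ℕ.* t ℕ.+ (3 ℕ.* s ℕ.+ 2 ℕ.* u′) ℕ.+ (t ℕ.+ (u ℕ.+ q ℕ.* 2))
        ≤⟨ ℕ.+-mono-≤ (ℕ.+-mono-≤ (ℕ.*-monoʳ-≤ 3 cover) rest) match ⟩
      3 ℕ.* (p ℕ.* 2 ℕ.+ s) ℕ.+ 8 ℕ.* q ℕ.+ (p ℕ.* 3 ℕ.+ u′)
        ≡⟨ solve 4 (λ p s q u′ → con 3 :* (p :* con 2 :+ s) :+ con 8 :* q :+ (p :* con 3 :+ u′)
             := con 9 :* p :+ con 6 :* q :+ (con 3 :* s :+ u′ :+ con 2 :* q)) refl p s q u′ ⟩
      9 ℕ.* p ℕ.+ 6 ℕ.* q ℕ.+ (3 ℕ.* s ℕ.+ u′ ℕ.+ 2 ℕ.* q) ∎))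
      where
      open ℕ.≤-Reasoning
      open +-*-Solver

-- Passage to the rationals, through unnormalised fractions of denominator 1.

fromℕ-mono-≤ : ∀ {a b} → a ℕ.≤ b → fromℕ a ≤ fromℕ b
fromℕ-mono-≤ {a} {b} a≤b = ℚ.toℚᵘ-cancel-≤ (begin
  toℚᵘ (fromℕ a)   ≃⟨ ℚ.toℚᵘ-fromℚᵘ (mkℚᵘ (+ a) 0) ⟩
  mkℚᵘ (+ a) 0     ≤⟨ ℚᵘ.*≤* (ℤ.*-monoʳ-≤-nonNeg (+ 1) (ℤ.+≤+ a≤b)) ⟩
  mkℚᵘ (+ b) 0     ≃⟨ ℚ.toℚᵘ-fromℚᵘ (mkℚᵘ (+ b) 0) ⟨
  toℚᵘ (fromℕ b)   ∎)
  where open ℚᵘ.≤-Reasoning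

fromℕ-+ : ∀ a b → fromℕ (a ℕ.+ b) ≡ fromℕ a + fromℕ b
fromℕ-+ a b = ℚ.toℚᵘ-injective (begin
  toℚᵘ (fromℕ (a ℕ.+ b))            ≈⟨ ℚ.toℚᵘ-fromℚᵘ (mkℚᵘ (+ (a ℕ.+ b)) 0) ⟩
  mkℚᵘ (+ (a ℕ.+ b)) 0              ≈⟨ ℚᵘ.*≡* (cong (ℤ._* + 1) (cong₂ ℤ._+_ (ℤ.*-identityʳ (+ a)) (ℤ.*-identityʳ (+ b)))) ⟨
  mkℚᵘ (+ a) 0 ℚᵘ.+ mkℚᵘ (+ b) 0    ≈⟨ ℚᵘ.+-cong (ℚ.toℚᵘ-fromℚᵘ (mkℚᵘ (+ a) 0)) (ℚ.toℚᵘ-fromℚᵘ (mkℚᵘ (+ b) 0)) ⟨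
  toℚᵘ (fromℕ a) ℚᵘ.+ toℚᵘ (fromℕ b) ≈⟨ ℚ.toℚᵘ-homo-+ (fromℕ a) (fromℕ b) ⟨
  toℚᵘ (fromℕ a + fromℕ b)          ∎)
  where open SetoidReasoning ℚᵘ.≃-setoid

fromℕ-* : ∀ a b → fromℕ (a ℕ.* b) ≡ fromℕ a * fromℕ b
fromℕ-* a b = ℚ.toℚᵘ-injective (begin
  toℚᵘ (fromℕ (a ℕ.* b))             ≈⟨ ℚ.toℚᵘ-fromℚᵘ (mkℚᵘ (+ (a ℕ.* b)) 0) ⟩
  mkℚᵘ (+ (a ℕ.* b)) 0               ≈⟨ ℚᵘ.*≡* (cong (ℤ._* + 1) (ℤ.pos-* a b)) ⟩
  mkℚᵘ (+ a) 0 ℚᵘ.* mkℚᵘ (+ b) 0     ≈⟨ ℚᵘ.*-cong (ℚ.toℚᵘ-fromℚᵘ (mkℚᵘ (+ a) 0)) (ℚ.toℚᵘ-fromℚᵘ (mkℚᵘ (+ b) 0)) ⟨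
  toℚᵘ (fromℕ a) ℚᵘ.* toℚᵘ (fromℕ b) ≈⟨ ℚ.toℚᵘ-homo-* (fromℕ a) (fromℕ b) ⟨
  toℚᵘ (fromℕ a * fromℕ b)           ∎)
  where open SetoidReasoning ℚᵘ.≃-setoid

first-bound-ℚ : ∀ t p u → 3 ℕ.* t ℕ.+ 2 ℕ.* u ℕ.≤ 8 ℕ.* p →
  fromℕ t ≤ (+ 8 / 3) * fromℕ p - (+ 2 / 3) * fromℕ u
first-bound-ℚ t p u bound = begin
  fromℕ t
    ≡⟨ solve 2 (λ t u → t := con (+ 1 / 3) :* (con (fromℕ 3) :* t :+ con (fromℕ 2) :* u) :- con (+ 2 / 3) :* u)
         refl (fromℕ t) (fromℕ u) ⟩
  (+ 1 / 3) * (fromℕ 3 * fromℕ t + fromℕ 2 * fromℕ u) - (+ 2 / 3) * fromℕ u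
    ≤⟨ ℚ.+-monoˡ-≤ _ (ℚ.*-monoˡ-≤-nonNeg (+ 1 / 3) (subst₂ _≤_
         (trans (fromℕ-+ (3 ℕ.* t) (2 ℕ.* u)) (cong₂ _+_ (fromℕ-* 3 t) (fromℕ-* 2 u)))
         (fromℕ-* 8 p) (fromℕ-mono-≤ bound))) ⟩
  (+ 1 / 3) * (fromℕ 8 * fromℕ p) - (+ 2 / 3) * fromℕ u
    ≡⟨ solve 2 (λ p u → con (+ 1 / 3) :* (con (fromℕ 8) :* p) :- con (+ 2 / 3) :* u
         := con (+ 8 / 3) :* p :- con (+ 2 / 3) :* u) refl (fromℕ p) (fromℕ u) ⟩
  (+ 8 / 3) * fromℕ p - (+ 2 / 3) * fromℕ u ∎
  where
  open ℚ.≤-Reasoning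
  open ℚ.+-*-Solver

second-bound-ℚ : ∀ t p q u → 4 ℕ.* t ℕ.+ u ℕ.≤ 9 ℕ.* p ℕ.+ 6 ℕ.* q →
  fromℕ t ≤ (+ 9 / 4) * fromℕ p + (+ 3 / 2) * fromℕ q - (+ 1 / 4) * fromℕ u
second-bound-ℚ t p q u bound = begin
  fromℕ t
    ≡⟨ solve 2 (λ t u → t := con (+ 1 / 4) :* (con (fromℕ 4) :* t :+ u) :- con (+ 1 / 4) :* u)
         refl (fromℕ t) (fromℕ u) ⟩
  (+ 1 / 4) * (fromℕ 4 * fromℕ t + fromℕ u) - (+ 1 / 4) * fromℕ u
    ≤⟨ ℚ.+-monoˡ-≤ _ (ℚ.*-monoˡ-≤-nonNeg (+ 1 / 4) (subst₂ _≤_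
         (trans (fromℕ-+ (4 ℕ.* t) u) (cong (_+ fromℕ u) (fromℕ-* 4 t)))
         (trans (fromℕ-+ (9 ℕ.* p) (6 ℕ.* q)) (cong₂ _+_ (fromℕ-* 9 p) (fromℕ-* 6 q)))
         (fromℕ-mono-≤ bound))) ⟩
  (+ 1 / 4) * (fromℕ 9 * fromℕ p + fromℕ 6 * fromℕ q) - (+ 1 / 4) * fromℕ u
    ≡⟨ solve 3 (λ p q u → con (+ 1 / 4) :* (con (fromℕ 9) :* p :+ con (fromℕ 6) :* q) :- con (+ 1 / 4) :* u
         := con (+ 9 / 4) :* p :+ con (+ 3 / 2) :* q :- con (+ 1 / 4) :* u)
         refl (fromℕ p) (fromℕ q) (fromℕ u) ⟩
  (+ 9 / 4) * fromℕ p + (+ 3 / 2) * fromℕ q - (+ 1 / 4) * fromℕ u ∎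
  where
  open ℚ.≤-Reasoning
  open ℚ.+-*-Solver

lemma2p3 : ∀ (n : ℕ) (H : ColouredGraph n) (P Q : List (Triangle n)) →
    MaximumPacking (𝓕 H) P →
    MaximumPacking (𝓕[ H ]after P) Q →
    let p = fromℕ (length P)
        q = fromℕ (length Q)
        u = fromℕ (length (filter (PrivateRed? H) P))
        t = fromℕ (τ (𝓕 H) (𝓕? H))
    in (t ≤ (+ 8 / 3) * p - (+ 2 / 3) * u)
     × (t ≤ (+ 9 / 4) * p + (+ 3 / 2) * q - (+ 1 / 4) * u)
lemma2p3 n H P Q maxP maxQ =
  first-bound-ℚ t p u (first-bound-ℕ maxP maxQ) ,
  second-bound-ℚ t p q u (second-bound-ℕ maxP maxQ)
  where
  p = length P
  q = length Q
  u = length (filter (PrivateRed? H) P)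
  t = τ (𝓕 H) (𝓕? H)
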